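{- Let $m>2$ be an integer, and let $\mathfrak{A}$ be the set of all algorithms $A$ such that, for the schedule $\sigma^A$ constructed by $A$, one has $J(\sigma_2)\subseteq J(\sigma^A)$. Then for each $A\in\mathfrak{A}$, $$F(\sigma^*)\le \frac{m}{2}\,F(\sigma^A)$$ for every instance with $m$ machines, and this performance guarantee is tight: for each $A\in\mathfrak{A}$ and each $\varepsilon>0$ there exists an instance with $m$ machines for which $$F(\sigma^*)>\left(\frac{m}{2}-\varepsilon\right)F(\sigma^A).$$ Here $F$, $J(\cdot)$, $\sigma^*$, $\sigma_2$, $\sigma^A$ and the notion of instance are as defined in the context.
   Context: An instance consists of a set $N=\{1,\dots,n\}$ of jobs, a number $m$ of identical parallel machines, a weight $w_j>0$ for each job $j\in N$, a common deadline $D$ (a positive integer), and an undirected conflict graph $G(N,E)$ whose edges are the pairs of jobs that cannot be processed concurrently. All jobs have processing time $p_j=1$ (unit execution time jobs). A (feasible) schedule $\sigma$ specifies for each $j\in N$ a starting time $S_j(\sigma)\ge 0$; job $j$ is processed without interruption by a single machine during $[S_j(\sigma),C_j(\sigma)]$, where $C_j(\sigma)=S_j(\sigma)+1$. Each machine processes at most one job at any point in time (except that one job may finish at the same instant at which another starts), so at most $m$ jobs are processed concurrently. Two jobs joined by an edge of $E$ are never processed concurrently, i.e. the interiors of their processing intervals are disjoint. Standing assumption: the minimum of the makespan $C_{\max}(\sigma)=\max_{j\in N}C_j(\sigma)$ over all feasible schedules on $m$ machines is greater than $D$. For a schedule $\sigma$, $J(\sigma)=\{j\in N: C_j(\sigma)\le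 D\}$ is the set of jobs completed on time, and $F(\sigma)=\sum_{j\in J(\sigma)}w_j$ is the total weight of on-time jobs. For a given instance: - $\sigma^*$ is an optimal schedule, i.e. a feasible schedule on $m$ machines with the largest value of $F$; - $\sigma_2$ is a schedule with the largest value of $F$ for the problem obtained from the instance by replacing the number of machines $m$ by $2$ (all other data unchanged); - for an algorithm $A$, $\sigma^A$ is the (feasible, $m$-machine) schedule constructed by $A$. The condition $J(\sigma_2)\subseteq J(\sigma^A)$ defining $\mathfrak{A}$ is required to hold on every instance. -}

module Defs where

open import Level using (Level; suc; _⊔_; 0ℓ)
open import Algebra.Bundles using (CommutativeRing)
open import Algebra.Structures using (IsCommutativeRing)
open import Data.Bool.Base using (if_then_else_)
open import Data.Fin.Base using (Fin)
open import Data.List.Base using (map; allFin)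
open import Data.Nat.Base as ℕ using (ℕ)
open import Data.Product.Base using (Σ-syntax; _×_)
open import Relation.Binary.Bundles using (DecTotalOrder)
open import Relation.Binary.Core using (Rel)
open import Relation.Binary.Definitions using (Decidable; Symmetric; Irreflexive)
open import Relation.Binary.PropositionalEquality.Core using (_≡_)
open import Relation.Binary.Structures using (IsDecTotalOrder)
open import Relation.Nullary.Decidable.Core using (does)
open import Relation.Nullary.Negation.Core using (¬_)
open import Relation.Unary using (Pred; _⊆_)
import Relation.Unary as Unary
import Algebra.Definitions.RawMonoid as RawMonoidDefs
import Data.List.Extrema as Extrema
import Relation.Binary.Properties.DecTotalOrder as DecTotalOrderProperties

-- The library has no real numbers, so times, weights and ε range over an
-- arbitrary ordered field.  Classically ℝ is one; ℚ is another.

record OrderedField c ℓ₁ ℓ₂ : Set (suc (c ⊔ ℓ₁ ⊔ ℓ₂)) where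
  infix  8 -_
  infixl 7 _*_
  infixl 6 _+_
  infix  4 _≈_ _≤_
  field
    Carrier           : Set c
    _≈_               : Rel Carrier ℓ₁
    _≤_               : Rel Carrier ℓ₂
    _+_               : Carrier → Carrier → Carrier
    _*_               : Carrier → Carrier → Carrier
    -_                : Carrier → Carrier
    _⁻¹               : Carrier → Carrier
    0#                : Carrier
    1#                : Carrier
    isCommutativeRing : IsCommutativeRing _≈_ _+_ _*_ -_ 0# 1#
    isDecTotalOrder   : IsDecTotalOrder _≈_ _≤_
    0#≉1#             : ¬ 0# ≈ 1#
    -- The value of 0# ⁻¹ is left unspecified.
    ⁻¹-inverseʳ       : ∀ x → ¬ x ≈ 0# → x * x ⁻¹ ≈ 1#
    +-monoʳ-≤         : ∀ x {y z} → y ≤ z → x + y ≤ x + z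
    *-nonNegative     : ∀ {x y} → 0# ≤ x → 0# ≤ y → 0# ≤ x * y

  commutativeRing : CommutativeRing c ℓ₁
  commutativeRing = record { isCommutativeRing = isCommutativeRing }

  decTotalOrder : DecTotalOrder c ℓ₁ ℓ₂
  decTotalOrder = record { isDecTotalOrder = isDecTotalOrder }

  open CommutativeRing commutativeRing public using (_-_; +-rawMonoid)
  open DecTotalOrder decTotalOrder public using (_≤?_; totalOrder)
  open DecTotalOrderProperties decTotalOrder public using (_<_)
  open RawMonoidDefs +-rawMonoid public using (sum) renaming (_×_ to _·_)
  open Extrema totalOrder public using (max)

  infixl 7 _/_
  _/_ : Carrier → Carrier → Carrier
  x / y = x * y ⁻¹

  fromℕ : ℕ → Carrier
  fromℕ n = n · 1#

module Scheduling {c ℓ₁ ℓ₂} (K : OrderedField c ℓ₁ ℓ₂) where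
  open OrderedField K

  record ConflictGraph (n : ℕ) : Set₁ where
    field
      Edge    : Rel (Fin n) 0ℓ
      edge?   : Decidable Edge
      symm    : Symmetric Edge
      irrefl  : Irreflexive _≡_ Edge

  -- All the data of an instance except the number of machines.
  record Problem : Set (suc 0ℓ ⊔ c ⊔ ℓ₁ ⊔ ℓ₂) where
    field
      n     : ℕ
      w     : Fin n → Carrier
      w>0   : ∀ j → 0# < w j
      D     : ℕ
      D>0   : 0 ℕ.< D
      graph : ConflictGraph n

    open ConflictGraph graph public

  module _ (P : Problem) where
    open Problem P

    record Schedule (k : ℕ) : Set (c ⊔ ℓ₁ ⊔ ℓ₂) where
      field
        S       : Fin n → Carrier
        S≥0     : ∀ j → 0# ≤ S j
        machine : Fin n → Fin k

      C : Fin n → Carrier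
      C j = S j + 1#

      -- t lies in the interior of the processing interval of j.
      Processing : Fin n → Carrier → Set (ℓ₁ ⊔ ℓ₂)
      Processing j t = S j < t × t < C j

      field
        capacity : ∀ {i j t} → machine i ≡ machine j →
                   Processing i t → Processing j t → i ≡ j
        conflict : ∀ {i j t} → Edge i j → ¬ (Processing i t × Processing j t)

  module _ {P : Problem} {k : ℕ} (σ : Schedule P k) where
    open Problem P
    open Schedule σ

    -- Completion times are positive, so starting from 0# does not affect the
    -- maximum when there is at least one job.
    Cmax : Carrier
    Cmax = max 0# (map C (allFin n))

    J : Pred (Fin n) ℓ₂
    J j = C j ≤ fromℕ D

    J? : Unary.Decidable J
    J? j = C j ≤? fromℕ D

    F : Carrier
    F = sum (λ j → if does (J? j) then w j else 0#)

  IsOptimal : ∀ {P k} → Schedule P k → Set (c ⊔ ℓ₁ ⊔ ℓ₂)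
  IsOptimal {P} {k} σ = ∀ (τ : Schedule P k) → F τ ≤ F σ

  record Instance (m : ℕ) : Set (suc 0ℓ ⊔ c ⊔ ℓ₁ ⊔ ℓ₂) where
    field
      problem     : Problem
      minMakespan : Σ[ σ ∈ Schedule problem m ]
                      (∀ (τ : Schedule problem m) → Cmax σ ≤ Cmax τ) ×
                      fromℕ (Problem.D problem) < Cmax σ

    open Problem problem public

  open Instance using (problem)

  Algorithm : ℕ → Set (suc 0ℓ ⊔ c ⊔ ℓ₁ ⊔ ℓ₂)
  Algorithm m = (I : Instance m) → Schedule (problem I) m

  -- An optimal two-machine schedule need not be unique.  Asking only for some
  -- such σ₂ gives the largest class: it contains the class obtained from any
  -- fixed choice of σ₂ for each instance.
  𝔄 : ∀ m → Pred (Algorithm m) (suc 0ℓ ⊔ c ⊔ ℓ₁ ⊔ ℓ₂)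
  𝔄 m A = ∀ (I : Instance m) →
    Σ[ σ₂ ∈ Schedule (problem I) 2 ] IsOptimal σ₂ × J σ₂ ⊆ J (A I)

{-# OPTIONS --safe #-}

-- The loads W i of the machines in a schedule on m machines satisfy
-- W i + W j ≤ F σ₂ for i ≠ j, because keeping the on-time jobs of machines i and
-- j and starting all others one after another from D on is a schedule on two
-- machines.  Averaging over pairs gives 2 F σ* ≤ m F σ₂ ≤ m F (A I).

module Submission where

open import Defs
open import Algebra.Bundles using (CommutativeRing)
open import Data.Bool.Base using (if_then_else_)
open import Data.Empty using (⊥-elim)
open import Data.Fin.Base using (Fin; zero; suc; toℕ)
open import Data.Fin.Properties as Fin using (0≢1+n; suc-injective; toℕ-injective)
open import Data.List.Base using (map; allFin)
import Data.List.Extrema as Extrema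
open import Data.List.Membership.Propositional.Properties using (∈-allFin; ∈-map⁺)
import Data.List.Relation.Unary.All as All
import Data.List.Relation.Unary.All.Properties as All
open import Data.Nat.Base as ℕ using (ℕ; zero; suc; z≤n; s≤s)
import Data.Nat.Properties as ℕ
open import Data.Product.Base using (Σ-syntax; ∃-syntax; _×_; _,_; proj₁; proj₂)
open import Data.Sum.Base as Sum using (_⊎_; inj₁; inj₂; [_,_]′)
open import Function.Base using (_∘_; id)
open import Relation.Binary.Bundles using (DecTotalOrder)
open import Relation.Binary.Definitions using (tri<; tri≈; tri>)
import Relation.Binary.Properties.DecTotalOrder as DecTotalOrderProperties
import Relation.Binary.Reasoning.PartialOrder as PartialOrderReasoning
open import Relation.Binary.PropositionalEquality as ≡ using (_≡_; _≢_)
open import Relation.Nullary.Decidable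
  using (Dec; decidable-stable; does; yes; no; ¬?; _×-dec_; _⊎-dec_)
open import Relation.Nullary.Negation using (¬_; contradiction)
open import Relation.Unary using (Pred; _∈_; _⊆_)

-- Arithmetic in an ordered field.

module OrderedFieldProperties {c ℓ₁ ℓ₂} (K : OrderedField c ℓ₁ ℓ₂) where
  open OrderedField K
  open CommutativeRing commutativeRing
    using (refl; sym; trans; +-cong; +-congˡ; +-congʳ; +-comm; +-assoc; +-identityˡ; +-identityʳ;
           -‿inverseˡ; *-congˡ; *-congʳ; *-comm; *-assoc; *-identityˡ; *-identityʳ;
           zeroʳ; ring; semiring; +-group; +-commutativeMonoid;
           commutativeSemiring)
  open DecTotalOrder decTotalOrder using (poset; total)
    renaming (refl to ≤-refl; trans to ≤-trans; reflexive to ≤-reflexive)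
  open DecTotalOrderProperties decTotalOrder using (<⇒≱)
  open import Algebra.Properties.Group +-group using (∙-cancelˡ; ⁻¹-involutive)
  open import Algebra.Properties.Ring ring using (-1*x≈-x)
  open import Algebra.Properties.CommutativeMonoid.Sum +-commutativeMonoid
    using (∑-comm; sum-replicate; sum-replicate-zero; sum-cong-≋)
  open import Algebra.Properties.Semiring.Mult semiring using (×-assoc-*; ×-congʳ)
  open import Algebra.Solver.Ring.NaturalCoefficients.Default commutativeSemiring
    using (solve; _:=_; _:+_; _:*_; con)
  open PartialOrderReasoning poset

  +-mono-≤ : ∀ {x y u v} → x ≤ y → u ≤ v → x + u ≤ y + v
  +-mono-≤ {x} {y} {u} {v} x≤y u≤v = begin
    x + u ≤⟨ +-monoʳ-≤ x u≤v ⟩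
    x + v ≈⟨ +-comm x v ⟩
    v + x ≤⟨ +-monoʳ-≤ v x≤y ⟩
    v + y ≈⟨ +-comm v y ⟩
    y + v ∎

  +-monoˡ-≤ : ∀ x {y z} → y ≤ z → y + x ≤ z + x
  +-monoˡ-≤ x y≤z = +-mono-≤ y≤z ≤-refl

  -x+[x+y]≈y : ∀ x y → - x + (x + y) ≈ y
  -x+[x+y]≈y x y = begin-equality
    - x + (x + y) ≈⟨ +-assoc (- x) x y ⟨
    - x + x + y   ≈⟨ +-congʳ (-‿inverseˡ x) ⟩
    0# + y        ≈⟨ +-identityˡ y ⟩
    y             ∎

  +-cancelˡ-≤ : ∀ x {y z} → x + y ≤ x + z → y ≤ z
  +-cancelˡ-≤ x {y} {z} xy≤xz = begin
    y             ≈⟨ -x+[x+y]≈y x y ⟨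
    - x + (x + y) ≤⟨ +-monoʳ-≤ (- x) xy≤xz ⟩
    - x + (x + z) ≈⟨ -x+[x+y]≈y x z ⟩
    z             ∎

  +-monoʳ-< : ∀ x {y z} → y < z → x + y < x + z
  +-monoʳ-< x (y≤z , y≉z) = +-monoʳ-≤ x y≤z , λ eq → y≉z (∙-cancelˡ x _ _ eq)

  +-mono-<-≤ : ∀ {x y u v} → x < y → u ≤ v → x + u < y + v
  +-mono-<-≤ {x} {y} {u} {v} x<y u≤v = begin-strict
    x + u ≤⟨ +-monoʳ-≤ x u≤v ⟩
    x + v ≈⟨ +-comm x v ⟩
    v + x <⟨ +-monoʳ-< v x<y ⟩
    v + y ≈⟨ +-comm v y ⟩
    y + v ∎

  x≤x+y : ∀ x {y} → 0# ≤ y → x ≤ x + y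
  x≤x+y x {y} 0≤y = begin
    x      ≈⟨ +-identityʳ x ⟨
    x + 0# ≤⟨ +-monoʳ-≤ x 0≤y ⟩
    x + y  ∎

  x<x+y : ∀ x {y} → 0# < y → x < x + y
  x<x+y x {y} 0<y = begin-strict
    x      ≈⟨ +-identityʳ x ⟨
    x + 0# <⟨ +-monoʳ-< x 0<y ⟩
    x + y  ∎

  +-nonNegative : ∀ {x y} → 0# ≤ x → 0# ≤ y → 0# ≤ x + y
  +-nonNegative 0≤x 0≤y = ≤-trans 0≤x (x≤x+y _ 0≤y)

  x<y+z⇒x-z<y : ∀ {x y} z → x < y + z → x - z < y
  x<y+z⇒x-z<y {x} {y} z x<y+z = begin-strict
    x - z           ≈⟨ +-comm x (- z) ⟩
    - z + x         <⟨ +-monoʳ-< (- z) x<y+z ⟩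
    - z + (y + z)   ≈⟨ +-congˡ (+-comm y z) ⟩
    - z + (z + y)   ≈⟨ -x+[x+y]≈y z y ⟩
    y               ∎

  -- If `y ≤ x`, then `x + x ≤ y + y ≤ x + y`, and cancelling `x` leaves `x ≤ y`. This halves
  -- doubled inequalities without division.
  x+x≤y+y⇒x≤y : ∀ {x y} → x + x ≤ y + y → x ≤ y
  x+x≤y+y⇒x≤y {x} {y} xx≤yy with total x y
  ... | inj₁ x≤y = x≤y
  ... | inj₂ y≤x = +-cancelˡ-≤ x (begin
    x + x ≤⟨ xx≤yy ⟩
    y + y ≤⟨ +-monoˡ-≤ y y≤x ⟩
    x + y ∎)

  -- If `1# ≤ 0#`, then `- 1#` is nonnegative, and `1#` is its square.
  0≤1 : 0# ≤ 1#
  0≤1 with total 0# 1#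
  ... | inj₁ 0≤1 = 0≤1
  ... | inj₂ 1≤0 = begin
    0#            ≤⟨ *-nonNegative 0≤-1 0≤-1 ⟩
    - 1# * - 1#   ≈⟨ -1*x≈-x (- 1#) ⟩
    - - 1#        ≈⟨ ⁻¹-involutive 1# ⟩
    1#            ∎
    where
    0≤-1 : 0# ≤ - 1#
    0≤-1 = begin
      0#        ≈⟨ -‿inverseˡ 1# ⟨
      - 1# + 1# ≤⟨ +-monoʳ-≤ (- 1#) 1≤0 ⟩
      - 1# + 0# ≈⟨ +-identityʳ (- 1#) ⟩
      - 1#      ∎

  0<1 : 0# < 1#
  0<1 = 0≤1 , 0#≉1#

  -- Were the product zero, multiplying it by `x ⁻¹` would make `y` zero.
  *-positive : ∀ {x y} → 0# < x → 0# < y → 0# < x * y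
  *-positive {x} {y} (0≤x , 0≉x) (0≤y , 0≉y) = *-nonNegative 0≤x 0≤y , λ 0≈xy →
    0≉y (begin-equality
      0#             ≈⟨ zeroʳ (x ⁻¹) ⟨
      x ⁻¹ * 0#      ≈⟨ *-congˡ 0≈xy ⟩
      x ⁻¹ * (x * y) ≈⟨ *-assoc _ _ _ ⟨
      x ⁻¹ * x * y   ≈⟨ *-congʳ (*-comm _ _) ⟩
      x * x ⁻¹ * y   ≈⟨ *-congʳ (⁻¹-inverseʳ x (0≉x ∘ sym)) ⟩
      1# * y         ≈⟨ *-identityˡ y ⟩
      y              ∎)

  ·-nonNegative : ∀ n {x} → 0# ≤ x → 0# ≤ n · x
  ·-nonNegative zero    0≤x = ≤-refl
  ·-nonNegative (suc n) 0≤x = +-nonNegative 0≤x (·-nonNegative n 0≤x)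

  ·-monoˡ-≤ : ∀ {m n x} → 0# ≤ x → m ℕ.≤ n → m · x ≤ n · x
  ·-monoˡ-≤ {n = n} 0≤x z≤n       = ·-nonNegative n 0≤x
  ·-monoˡ-≤         0≤x (s≤s m≤n) = +-monoʳ-≤ _ (·-monoˡ-≤ 0≤x m≤n)

  ·≈fromℕ* : ∀ n x → n · x ≈ fromℕ n * x
  ·≈fromℕ* n x = sym (trans (×-assoc-* n 1# x) (×-congʳ n (*-identityˡ x)))

  fromℕ-suc : ∀ n → fromℕ n + 1# ≈ fromℕ (suc n)
  fromℕ-suc n = +-comm (fromℕ n) 1#

  -- The interval starting at the smaller integer ends by the start of the other. This reduces
  -- disjointness of processing intervals to distinctness of integer slots.
  unitInterval-injective : ∀ {m n t} → fromℕ m < t × t < fromℕ m + 1# →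
                           fromℕ n < t × t < fromℕ n + 1# → m ≡ n
  unitInterval-injective {m} {n} (m<t , t<m+1) (n<t , t<n+1) with ℕ.<-cmp m n
  ... | tri≈ _ m≡n _ = m≡n
  ... | tri< m<n _ _ = contradiction n<t (λ n<t → <⇒≱ t<m+1 (begin
    fromℕ m + 1#  ≈⟨ fromℕ-suc m ⟩
    fromℕ (suc m) ≤⟨ ·-monoˡ-≤ 0≤1 m<n ⟩
    fromℕ n       ≤⟨ proj₁ n<t ⟩
    _             ∎))
  ... | tri> _ _ n<m = contradiction m<t (λ m<t → <⇒≱ t<n+1 (begin
    fromℕ n + 1#  ≈⟨ fromℕ-suc n ⟩
    fromℕ (suc n) ≤⟨ ·-monoˡ-≤ 0≤1 n<m ⟩
    fromℕ m       ≤⟨ proj₁ m<t ⟩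
    _             ∎))

  x/2+x/2≈x : ∀ x → x / fromℕ 2 + x / fromℕ 2 ≈ x
  x/2+x/2≈x x = begin-equality
    x * ½ + x * ½             ≈⟨ solve 2 (λ x h → x :* h :+ x :* h := x :* ((con 2) :* h)) refl x ½ ⟩
    x * ((1# + 1#) * ½)       ≈⟨ *-congˡ (*-congʳ (+-congˡ (+-identityʳ 1#))) ⟨
    x * (fromℕ 2 * ½)         ≈⟨ *-congˡ (⁻¹-inverseʳ (fromℕ 2) 2≉0) ⟩
    x * 1#                    ≈⟨ *-identityʳ x ⟩
    x                         ∎
    where
    ½ : Carrier
    ½ = fromℕ 2 ⁻¹

    -- Since `1# ≤ fromℕ 2`, a vanishing `fromℕ 2` would contradict `0<1`.
    2≉0 : ¬ fromℕ 2 ≈ 0#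
    2≉0 2≈0 = <⇒≱ 0<1 (≤-trans (x≤x+y 1# (·-nonNegative 1 0≤1)) (≤-reflexive 2≈0))

  -- The midpoint works; it is compared with either end after doubling. It supplies the common
  -- instant of two overlapping jobs in `disjoint⇒C≤S`.
  dense : ∀ {x y} → x < y → ∃[ z ] x < z × z < y
  dense {x} {y} x<y@(x≤y , x≉y) = z
    , (x+x≤y+y⇒x≤y (begin x + x ≤⟨ +-monoʳ-≤ x x≤y ⟩ x + y ≈⟨ z+z ⟨ z + z ∎)
      , λ x≈z → x≉y (∙-cancelˡ x _ _ (begin-equality
          x + x ≈⟨ +-cong x≈z x≈z ⟩ z + z ≈⟨ z+z ⟩ x + y ∎)))
    , (x+x≤y+y⇒x≤y (begin z + z ≈⟨ z+z ⟩ x + y ≤⟨ +-monoˡ-≤ y x≤y ⟩ y + y ∎)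
      , λ z≈y → x≉y (∙-cancelˡ y _ _ (begin-equality
          y + x ≈⟨ +-comm y x ⟩ x + y ≈⟨ z+z ⟨ z + z ≈⟨ +-cong z≈y z≈y ⟩ y + y ∎)))
    where
    z : Carrier
    z = (x + y) / fromℕ 2

    z+z : z + z ≈ x + y
    z+z = x/2+x/2≈x (x + y)

  -- Bounds and rearrangements of finite sums.

  sum-mono-≤ : ∀ {n} {f g : Fin n → Carrier} → (∀ i → f i ≤ g i) → sum f ≤ sum g
  sum-mono-≤ {zero}  f≤g = ≤-refl
  sum-mono-≤ {suc n} f≤g = +-mono-≤ (f≤g zero) (sum-mono-≤ (f≤g ∘ suc))

  sum-upperBound : ∀ {n b} {f : Fin n → Carrier} → (∀ i → f i ≤ b) → sum f ≤ n · b
  sum-upperBound {n} f≤b = ≤-trans (sum-mono-≤ f≤b) (≤-reflexive (sum-replicate n))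

  sum-lowerBound : ∀ {n b} {f : Fin n → Carrier} → (∀ i → b ≤ f i) → n · b ≤ sum f
  sum-lowerBound {n} b≤f = ≤-trans (≤-reflexive (sym (sum-replicate n))) (sum-mono-≤ b≤f)

  sum-nonPositive : ∀ {n} {f : Fin n → Carrier} → (∀ i → f i ≤ 0#) → sum f ≤ 0#
  sum-nonPositive {n} f≤0 = ≤-trans (sum-mono-≤ f≤0) (≤-reflexive (sum-replicate-zero n))

  -- Once an index in `P` is met, uniqueness forces all later terms to be nonpositive. Meant for the
  -- on-time jobs of one machine when the deadline is 1.
  sum-atMostOne : ∀ {n p b} {P : Pred (Fin n) p} {f : Fin n → Carrier} → 0# ≤ b →
                  (∀ {i j} → P i → P j → i ≡ j) →
                  (∀ i → (P i × f i ≤ b) ⊎ f i ≤ 0#) → sum f ≤ b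
  sum-atMostOne {zero}                  0≤b uniq bound = 0≤b
  sum-atMostOne {suc n} {b = b} {P} {f} 0≤b uniq bound with bound zero
  ... | inj₂ f₀≤0 = begin
    f zero + sum (f ∘ suc)
      ≤⟨ +-mono-≤ f₀≤0 (sum-atMostOne 0≤b (λ p q → suc-injective (uniq p q)) (bound ∘ suc)) ⟩
    0# + b
      ≈⟨ +-identityˡ b ⟩
    b ∎
  ... | inj₁ (p₀ , f₀≤b) = begin
    f zero + sum (f ∘ suc) ≤⟨ +-mono-≤ f₀≤b (sum-nonPositive rest) ⟩
    b + 0#                 ≈⟨ +-identityʳ b ⟩
    b                      ∎
    where
    rest : ∀ i → f (suc i) ≤ 0#
    rest i = [ (λ (p , _) → contradiction (uniq p₀ p) 0≢1+n) , id ]′ (bound (suc i))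

  sum-indicator : ∀ {n} (k : Fin n) x → sum (λ i → if does (k Fin.≟ i) then x else 0#) ≈ x
  sum-indicator {suc n} zero    x = trans (+-congˡ (sum-replicate-zero n)) (+-identityʳ x)
  sum-indicator {suc n} (suc k) x = trans (+-identityˡ _) (sum-indicator k x)

  -- Each term is spread over all `i` by the indicator of `g j`, and the two sums are exchanged.
  sum-fibres : ∀ {n k} (g : Fin n → Fin k) (f : Fin n → Carrier) →
               sum f ≈ sum (λ i → sum (λ j → if does (g j Fin.≟ i) then f j else 0#))
  sum-fibres g f = trans (sum-cong-≋ (λ j → sym (sum-indicator (g j) (f j))))
    (∑-comm (λ j i → if does (g j Fin.≟ i) then f j else 0#))

  -- With every index counted twice, the sum splits into as many pairs of distinct indices as there
  -- are indices. Two leading indices are paired with each other twice and removed, until two or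
  -- three are left; three are paired around a triangle.
  sum-pairs-≤ : ∀ n {b} (f : Fin (2 ℕ.+ n) → Carrier) → (∀ {i j} → i ≢ j → f i + f j ≤ b) →
                sum f + sum f ≤ (2 ℕ.+ n) · b
  sum-pairs-≤ zero {b} f pairs = begin
    sum f + sum f
      ≈⟨ solve 2 (λ x y → (x :+ (y :+ con 0)) :+ (x :+ (y :+ con 0))
                          := (x :+ y) :+ ((x :+ y) :+ con 0)) refl x y ⟩
    (x + y) + ((x + y) + 0#)
      ≤⟨ +-mono-≤ x+y≤b (+-monoˡ-≤ 0# x+y≤b) ⟩
    b + (b + 0#) ∎
    where
    x y : Carrier
    x = f zero
    y = f (suc zero)

    x+y≤b : x + y ≤ b
    x+y≤b = pairs λ ()
  sum-pairs-≤ (suc zero) {b} f pairs = begin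
    sum f + sum f
      ≈⟨ solve 3 (λ x y z → (x :+ (y :+ (z :+ con 0))) :+ (x :+ (y :+ (z :+ con 0)))
                            := (x :+ y) :+ ((y :+ z) :+ ((x :+ z) :+ con 0))) refl x y z ⟩
    (x + y) + ((y + z) + ((x + z) + 0#))
      ≤⟨ +-mono-≤ (pairs λ ()) (+-mono-≤ (pairs λ ()) (+-monoˡ-≤ 0# (pairs λ ()))) ⟩
    b + (b + (b + 0#)) ∎
    where
    x y z : Carrier
    x = f zero
    y = f (suc zero)
    z = f (suc (suc zero))
  sum-pairs-≤ (suc (suc n)) {b} f pairs = begin
    sum f + sum f
      ≈⟨ solve 3 (λ x y s → (x :+ (y :+ s)) :+ (x :+ (y :+ s))
                            := (x :+ y) :+ ((x :+ y) :+ (s :+ s))) refl x y s ⟩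
    (x + y) + ((x + y) + (s + s))
      ≤⟨ +-mono-≤ x+y≤b (+-mono-≤ x+y≤b (sum-pairs-≤ n (λ i → f (suc (suc i)))
           (λ i≢j → pairs (i≢j ∘ suc-injective ∘ suc-injective)))) ⟩
    b + (b + (2 ℕ.+ n) · b) ∎
    where
    x y s : Carrier
    x = f zero
    y = f (suc zero)
    s = sum (λ i → f (suc (suc i)))

    x+y≤b : x + y ≤ b
    x+y≤b = pairs λ ()

module SchedulingProperties {c ℓ₁ ℓ₂} (K : OrderedField c ℓ₁ ℓ₂) where
  open OrderedField K
  open OrderedFieldProperties K
  open Scheduling K
  open Instance using (problem)
  open CommutativeRing commutativeRing
    using (refl; sym; trans; +-cong; +-congˡ; +-congʳ; +-assoc; +-identityˡ; +-identityʳ; *-congˡ; *-congʳ;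
           distribˡ; distribʳ; ring; +-commutativeMonoid; commutativeSemiring)
  open DecTotalOrder decTotalOrder using (poset; total)
    renaming (refl to ≤-refl; trans to ≤-trans; reflexive to ≤-reflexive)
  open DecTotalOrderProperties decTotalOrder using (<⇒≱; ≰⇒>; <-respʳ-≈)
  open import Algebra.Properties.CommutativeMonoid.Sum +-commutativeMonoid
    using (∑-distrib-+; sum-replicate-zero; sum-cong-≋)
  open import Algebra.Properties.Ring ring using ([y-z]x≈yx-zx)
  open import Algebra.Solver.Ring.NaturalCoefficients.Default commutativeSemiring
    using (solve; _:=_; _:+_; _:*_; con)
  open PartialOrderReasoning poset
  private module Max = Extrema totalOrder

  -- On-time values and machine loads.

  module _ {P : Problem} {k : ℕ} (σ : Schedule P k) where
    open Problem P
    open Schedule σ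

    -- `F σ` unfolds to `sum value`, so `F` can be bounded term by term.
    value : Fin n → Carrier
    value j = if does (J? σ j) then w j else 0#

    load : Fin k → Carrier
    load i = sum (λ j → if does (machine j Fin.≟ i) then value j else 0#)

    F≈∑load : F σ ≈ sum load
    F≈∑load = sum-fibres machine value

    value-onTime : ∀ {j} → J σ j → value j ≈ w j
    value-onTime {j} j∈J with J? σ j
    ... | yes _  = refl
    ... | no j∉J = contradiction j∈J j∉J

    value-late : ∀ {j} → ¬ J σ j → value j ≈ 0#
    value-late {j} j∉J with J? σ j
    ... | yes j∈J = contradiction j∈J j∉J
    ... | no _    = refl

    value-nonNegative : ∀ j → 0# ≤ value j
    value-nonNegative j with J? σ j
    ... | yes _ = proj₁ (w>0 j)
    ... | no _  = ≤-refl

    value≤w : ∀ j → value j ≤ w j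
    value≤w j with J? σ j
    ... | yes _ = ≤-refl
    ... | no _  = proj₁ (w>0 j)

    -- Completion times, makespan and deadline 1.

    1≤C : ∀ j → 1# ≤ C j
    1≤C j = begin
      1#       ≈⟨ +-identityˡ 1# ⟨
      0# + 1#  ≤⟨ +-monoˡ-≤ 1# (S≥0 j) ⟩
      S j + 1# ∎

    C≤Cmax : ∀ j → C j ≤ Cmax σ
    C≤Cmax j = All.lookup (Max.xs≤max 0# (map C (allFin n))) (∈-map⁺ C (∈-allFin j))

    Cmax-least : ∀ {x} → 0# ≤ x → (∀ j → C j ≤ x) → Cmax σ ≤ x
    Cmax-least 0≤x C≤x = Max.max≤v⁺ 0≤x (All.map⁺ (All.universal C≤x (allFin n)))

    -- If `S j < C i`, an instant strictly between them lies inside both intervals: `j` starts no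
    -- earlier than `i`, and having the same length it ends no earlier.
    disjoint⇒C≤S : ∀ {i j} → (∀ t → ¬ (Processing i t × Processing j t)) → S i ≤ S j → C i ≤ S j
    disjoint⇒C≤S {i} {j} disjoint Sᵢ≤Sⱼ with C i ≤? S j
    ... | yes Cᵢ≤Sⱼ = Cᵢ≤Sⱼ
    ... | no  Cᵢ≰Sⱼ with dense (≰⇒> Cᵢ≰Sⱼ)
    ...   | t , Sⱼ<t , t<Cᵢ = contradiction
      ( ((begin-strict S i ≤⟨ Sᵢ≤Sⱼ ⟩ S j <⟨ Sⱼ<t ⟩ t ∎) , t<Cᵢ)
      , (Sⱼ<t , (begin-strict t <⟨ t<Cᵢ ⟩ C i ≤⟨ +-monoˡ-≤ 1# Sᵢ≤Sⱼ ⟩ C j ∎)))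
      (disjoint t)

    disjoint⇒sequential : ∀ {i j} → (∀ t → ¬ (Processing i t × Processing j t)) →
                          C i ≤ S j ⊎ C j ≤ S i
    disjoint⇒sequential {i} {j} disjoint =
      Sum.map (disjoint⇒C≤S disjoint) (disjoint⇒C≤S (λ t (pⱼ , pᵢ) → disjoint t (pᵢ , pⱼ)))
              (total (S i) (S j))

    -- The later of the two jobs starts at time 1 or after, when the other has been completed.
    disjoint⇒2≤Cmax : ∀ {i j} → (∀ t → ¬ (Processing i t × Processing j t)) → fromℕ 2 ≤ Cmax σ
    disjoint⇒2≤Cmax {i} {j} disjoint = [ lemma , lemma ]′ (disjoint⇒sequential disjoint)
      where
      lemma : ∀ {i j} → C i ≤ S j → fromℕ 2 ≤ Cmax σ
      lemma {i} {j} Cᵢ≤Sⱼ = begin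
        fromℕ 2         ≈⟨ fromℕ-suc 1 ⟨
        fromℕ 1 + 1#    ≈⟨ +-congʳ (+-identityʳ 1#) ⟩
        1# + 1#         ≤⟨ +-monoˡ-≤ 1# (1≤C i) ⟩
        C i + 1#        ≤⟨ +-monoˡ-≤ 1# Cᵢ≤Sⱼ ⟩
        C j             ≤⟨ C≤Cmax j ⟩
        Cmax σ          ∎

    -- Of two disjoint jobs the later one completes at 2 or after, hence late. The conclusion is
    -- negative, with no common instant exhibited; its uses only derive contradictions.
    unitDeadline-overlap : D ≡ 1 → ∀ {i j} → J σ i → J σ j →
                           ¬ (∀ t → ¬ (Processing i t × Processing j t))
    unitDeadline-overlap ≡.refl {i} {j} i∈J j∈J disjoint =
      [ lemma j∈J , lemma i∈J ]′ (disjoint⇒sequential disjoint)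
      where
      lemma : ∀ {i j} → J σ j → ¬ C i ≤ S j
      lemma {i} {j} j∈J Cᵢ≤Sⱼ = <⇒≱ 0<1 (+-cancelˡ-≤ 1# (begin
        1# + 1#    ≤⟨ +-monoˡ-≤ 1# (1≤C i) ⟩
        C i + 1#   ≤⟨ +-monoˡ-≤ 1# Cᵢ≤Sⱼ ⟩
        C j        ≤⟨ j∈J ⟩
        1# + 0#    ∎))

    unitDeadline-conflict : D ≡ 1 → ∀ {i j} → Edge i j → J σ i → ¬ J σ j
    unitDeadline-conflict D≡1 e i∈J j∈J = unitDeadline-overlap D≡1 i∈J j∈J (λ t → conflict e)

    unitDeadline-capacity : D ≡ 1 → ∀ {i j} → machine i ≡ machine j → J σ i → J σ j → i ≡ j
    unitDeadline-capacity D≡1 {i} {j} mᵢ≡mⱼ i∈J j∈J with i Fin.≟ j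
    ... | yes i≡j = i≡j
    ... | no  i≢j = ⊥-elim (unitDeadline-overlap D≡1 i∈J j∈J
                      (λ t (pᵢ , pⱼ) → i≢j (capacity mᵢ≡mⱼ pᵢ pⱼ)))

  -- The numbers of machines may differ, as the value of a job depends only on whether it is on
  -- time. This is what lets σ₂ be compared with the schedule of an algorithm.
  value-mono : ∀ {P k l} (σ : Schedule P k) (τ : Schedule P l) {j} →
               (J σ j → J τ j) → value σ j ≤ value τ j
  value-mono σ τ {j} J⊆ with J? σ j
  ... | yes j∈J = ≤-reflexive (sym (value-onTime τ (J⊆ j∈J)))
  ... | no  _   = value-nonNegative τ j

  F-mono : ∀ {P k l} (σ : Schedule P k) (τ : Schedule P l) → J σ ⊆ J τ → F σ ≤ F τ
  F-mono σ τ J⊆ = sum-mono-≤ {f = value σ} {value τ} (λ j → value-mono σ τ J⊆)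

  -- Constructing schedules.

  module _ {P : Problem} where
    open Problem P

    -- With integer starting times, two jobs overlap only if they share a slot, so both feasibility
    -- conditions become statements about slots.
    slotSchedule : ∀ {k} (slot : Fin n → ℕ) (machine : Fin n → Fin k) →
                   (∀ {i j} → machine i ≡ machine j → slot i ≡ slot j → i ≡ j) →
                   (∀ {i j} → Edge i j → slot i ≢ slot j) → Schedule P k
    slotSchedule slot machine injective conflictFree = record
      { S        = λ j → fromℕ (slot j)
      ; S≥0      = λ j → ·-nonNegative (slot j) 0≤1
      ; machine  = machine
      ; capacity = λ mᵢ≡mⱼ pᵢ pⱼ → injective mᵢ≡mⱼ (unitInterval-injective pᵢ pⱼ)
      ; conflict = λ e (pᵢ , pⱼ) → conflictFree e (unitInterval-injective pᵢ pⱼ)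
      }

    module TwoMachines {k} (σ : Schedule P k) (a b : Fin k) (a≢b : a ≢ b) where
      open Schedule σ

      Kept : Pred (Fin n) _
      Kept j = J σ j × (machine j ≡ a ⊎ machine j ≡ b)

      -- Opaque, as otherwise  does (kept? j)  unfolds and escapes with-abstraction.
      opaque
        kept? : ∀ j → Dec (Kept j)
        kept? j = J? σ j ×-dec (machine j Fin.≟ a ⊎-dec machine j Fin.≟ b)

      -- Jobs that are not kept start at `D` or later, when all kept jobs are finished; adding
      -- `toℕ j` gives each of them a slot of its own.
      S′ : Fin n → Carrier
      S′ j = if does (kept? j) then S j else fromℕ (D ℕ.+ toℕ j)

      Processing′ : Fin n → Carrier → Set _
      Processing′ j t = S′ j < t × t < S′ j + 1#

      -- A job that is not kept may share a machine with a kept one; `overlap⇒kept` excludes that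
      -- they overlap.
      machine′ : Fin n → Fin 2
      machine′ j = if does (machine j Fin.≟ a) then zero else suc zero

      S′≥0 : ∀ j → 0# ≤ S′ j
      S′≥0 j with kept? j
      ... | yes _ = S≥0 j
      ... | no  _ = ·-nonNegative (D ℕ.+ toℕ j) 0≤1

      onTime∧late⇒⊥ : ∀ {i t} s → J σ i → t < C i → ¬ fromℕ (D ℕ.+ s) < t
      onTime∧late⇒⊥ {i} {t} s i∈J t<Cᵢ D+s<t = <⇒≱ D+s<t (begin
        t                 ≤⟨ proj₁ t<Cᵢ ⟩
        C i               ≤⟨ i∈J ⟩
        fromℕ D           ≤⟨ ·-monoˡ-≤ 0≤1 (ℕ.m≤m+n D s) ⟩
        fromℕ (D ℕ.+ s)   ∎)

      -- Kept jobs retain their times, a kept and a postponed job are separated by `D`, and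
      -- postponed jobs have distinct slots. Capacity and conflict are thus inherited from `σ`.
      overlap⇒kept : ∀ {i j t} → Processing′ i t → Processing′ j t →
                     (Kept i × Kept j × Processing i t × Processing j t) ⊎ i ≡ j
      overlap⇒kept {i} {j} pᵢ pⱼ with kept? i | kept? j
      ... | yes kᵢ | yes kⱼ = inj₁ (kᵢ , kⱼ , pᵢ , pⱼ)
      ... | yes kᵢ | no  _  = contradiction (proj₁ pⱼ) (onTime∧late⇒⊥ (toℕ j) (proj₁ kᵢ) (proj₂ pᵢ))
      ... | no  _  | yes kⱼ = contradiction (proj₁ pᵢ) (onTime∧late⇒⊥ (toℕ i) (proj₁ kⱼ) (proj₂ pⱼ))
      ... | no  _  | no  _  =
        inj₂ (toℕ-injective (ℕ.+-cancelˡ-≡ D _ _ (unitInterval-injective pᵢ pⱼ)))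

      -- A kept job that is not on `a` must be on `b`, so on kept jobs the merged second machine is
      -- just `b`.
      machine′-injective : ∀ {i j} → Kept i → Kept j → machine′ i ≡ machine′ j → machine i ≡ machine j
      machine′-injective {i} {j} kᵢ kⱼ eq with machine i Fin.≟ a | machine j Fin.≟ a
      ... | yes mᵢ≡a | yes mⱼ≡a = ≡.trans mᵢ≡a (≡.sym mⱼ≡a)
      ... | no  mᵢ≢a | no  mⱼ≢a = ≡.trans (onB kᵢ mᵢ≢a) (≡.sym (onB kⱼ mⱼ≢a))
        where
        onB : ∀ {j} → Kept j → machine j ≢ a → machine j ≡ b
        onB (_ , inj₁ m≡a) m≢a = contradiction m≡a m≢a
        onB (_ , inj₂ m≡b) _   = m≡b

      schedule : Schedule P 2
      schedule = record
        { S        = S′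
        ; S≥0      = S′≥0
        ; machine  = machine′
        ; capacity = λ eq p q →
            [ (λ (kᵢ , kⱼ , pᵢ , pⱼ) → capacity (machine′-injective kᵢ kⱼ eq) pᵢ pⱼ) , id ]′
            (overlap⇒kept p q)
        ; conflict = λ e (p , q) →
            [ (λ (_ , _ , pᵢ , pⱼ) → conflict e (pᵢ , pⱼ)) , (λ i≡j → irrefl i≡j e) ]′
            (overlap⇒kept p q)
        }

      Kept⊆J : Kept ⊆ J schedule
      Kept⊆J {j} kⱼ with kept? j
      ... | yes _ = proj₁ kⱼ
      ... | no ¬k = contradiction kⱼ ¬k

      -- As `a ≢ b`, a job counts in at most one of the two loads; if it is on time there, it is
      -- kept and so on time in `schedule`.
      load+load≤F : load σ a + load σ b ≤ F schedule
      load+load≤F = begin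
        load σ a + load σ b                  ≈⟨ ∑-distrib-+ (on a) (on b) ⟨
        sum (λ j → on a j + on b j)          ≤⟨ sum-mono-≤ pointwise ⟩
        F schedule                           ∎
        where
        on : Fin k → Fin n → Carrier
        on i j = if does (machine j Fin.≟ i) then value σ j else 0#

        pointwise : ∀ j → on a j + on b j ≤ value schedule j
        pointwise j with machine j Fin.≟ a | machine j Fin.≟ b
        ... | yes m≡a | yes m≡b = contradiction (≡.trans (≡.sym m≡a) m≡b) a≢b
        ... | yes m≡a | no  _   = ≤-trans (≤-reflexive (+-identityʳ _))
                                    (value-mono σ schedule (λ j∈J → Kept⊆J (j∈J , inj₁ m≡a)))
        ... | no  _   | yes m≡b = ≤-trans (≤-reflexive (+-identityˡ _))
                                    (value-mono σ schedule (λ j∈J → Kept⊆J (j∈J , inj₂ m≡b)))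
        ... | no  _   | no  _   = ≤-trans (≤-reflexive (+-identityˡ _)) (value-nonNegative schedule j)

  -- The inequality is proved doubled: `sum-pairs-≤` applied to the loads bounds the left side by
  -- `m · b`, and twice `m / 2` is `m`.
  F≤m/2*bound : ∀ n {P} (σ : Schedule P (2 ℕ.+ n)) {b} → (∀ (τ : Schedule P 2) → F τ ≤ b) →
                F σ ≤ fromℕ (2 ℕ.+ n) / fromℕ 2 * b
  F≤m/2*bound n σ {b} F≤b = x+x≤y+y⇒x≤y (begin
    F σ + F σ
      ≈⟨ +-cong (F≈∑load σ) (F≈∑load σ) ⟩
    sum (load σ) + sum (load σ)
      ≤⟨ sum-pairs-≤ n (load σ) (λ {i} {j} i≢j → let open TwoMachines σ i j i≢j in
           ≤-trans load+load≤F (F≤b schedule)) ⟩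
    m · b
      ≈⟨ ·≈fromℕ* m b ⟩
    fromℕ m * b
      ≈⟨ *-congʳ (x/2+x/2≈x (fromℕ m)) ⟨
    (fromℕ m / fromℕ 2 + fromℕ m / fromℕ 2) * b
      ≈⟨ distribʳ b _ _ ⟩
    fromℕ m / fromℕ 2 * b + fromℕ m / fromℕ 2 * b ∎)
    where
    m : ℕ
    m = 2 ℕ.+ n

  -- Kept generic in P: for a concrete P, unification unfolds Cmax.
  toInstance : ∀ {m} (P : Problem) (σ : Schedule P m) → (∀ (τ : Schedule P m) → Cmax σ ≤ Cmax τ) →
               fromℕ (Problem.D P) < Cmax σ → Instance m
  toInstance P σ minimal D<Cmax = record { problem = P ; minMakespan = σ , minimal , D<Cmax }

  -- Every heavy job conflicts with every light one and D = 1.  Two machines do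
  -- best on the two heavy jobs, which then exclude all light ones, while m
  -- machines do best on the m light jobs.
  module Tightness (n : ℕ) {ε : Carrier} (0<ε : 0# < ε) where

    -- The tight instance.

    m : ℕ
    m = 3 ℕ.+ n

    -- Chosen so that 2 heavy ≤ m light and m ε < 2 heavy ε.
    light heavy : Carrier
    light = fromℕ m + (ε + ε)
    heavy = light + ε

    -- Plays two roles: the side of the complete bipartite conflict graph, and the time slot in
    -- `lightSchedule`.
    phase : Fin (2 ℕ.+ m) → ℕ
    phase zero          = 1
    phase (suc zero)    = 1
    phase (suc (suc _)) = 0

    weight : Fin (2 ℕ.+ m) → Carrier
    weight zero          = heavy
    weight (suc zero)    = heavy
    weight (suc (suc _)) = light

    ε+ε≤light : ε + ε ≤ light
    ε+ε≤light = begin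
      ε + ε        ≈⟨ +-identityˡ _ ⟨
      0# + (ε + ε) ≤⟨ +-monoˡ-≤ _ (·-nonNegative m 0≤1) ⟩
      light        ∎

    0<light : 0# < light
    0<light = begin-strict
      0#      <⟨ 0<ε ⟩
      ε       ≤⟨ x≤x+y ε (proj₁ 0<ε) ⟩
      ε + ε   ≤⟨ ε+ε≤light ⟩
      light   ∎

    light<heavy : light < heavy
    light<heavy = x<x+y light 0<ε

    0<heavy : 0# < heavy
    0<heavy = begin-strict 0# <⟨ 0<light ⟩ light <⟨ light<heavy ⟩ heavy ∎

    weight>0 : ∀ j → 0# < weight j
    weight>0 zero          = 0<heavy
    weight>0 (suc zero)    = 0<heavy
    weight>0 (suc (suc _)) = 0<light

    P : Problem
    P = record
      { n     = 2 ℕ.+ m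
      ; w     = weight
      ; w>0   = weight>0
      ; D     = 1
      ; D>0   = s≤s z≤n
      ; graph = record
        { Edge   = λ i j → phase i ≢ phase j
        ; edge?  = λ i j → ¬? (phase i ℕ.≟ phase j)
        ; symm   = λ i≁j → i≁j ∘ ≡.sym
        ; irrefl = λ i≡j i≁j → i≁j (≡.cong phase i≡j)
        }
      }

    -- Two heavy weights exceed two light ones by `ε + ε`, which a third light weight covers. Here
    -- `m ≥ 3` enters.
    heavy+heavy≤m·light : heavy + heavy ≤ m · light
    heavy+heavy≤m·light = begin
      heavy + heavy
        ≈⟨ solve 2 (λ l e → (l :+ e) :+ (l :+ e) := (l :+ l) :+ (e :+ e)) refl light ε ⟩
      (light + light) + (ε + ε)
        ≤⟨ +-monoʳ-≤ (light + light) ε+ε≤light ⟩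
      (light + light) + light
        ≈⟨ solve 1 (λ l → (l :+ l) :+ l := l :+ (l :+ (l :+ con 0))) refl light ⟩
      3 · light
        ≤⟨ ·-monoˡ-≤ (proj₁ 0<light) (ℕ.m≤m+n 3 n) ⟩
      m · light ∎

    -- Every light job conflicts with `h`, so with deadline 1 all of them are late and only the
    -- first two summands survive.
    heavyOnTime⇒F : ∀ {k} (σ : Schedule P k) {h} → phase h ≡ 1 → J σ h →
                    F σ ≈ value σ zero + value σ (suc zero)
    heavyOnTime⇒F σ {h} h-heavy h∈J = +-congˡ (begin-equality
      value σ (suc zero) + sum (λ i → value σ (suc (suc i)))
        ≈⟨ +-congˡ (trans (sum-cong-≋ late) (sum-replicate-zero m)) ⟩
      value σ (suc zero) + 0#
        ≈⟨ +-identityʳ _ ⟩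
      value σ (suc zero) ∎)
      where
      late : ∀ i → value σ (suc (suc i)) ≈ 0#
      late i = value-late σ (unitDeadline-conflict σ ≡.refl
                 (λ h~i → contradiction (≡.trans (≡.sym h-heavy) h~i) λ ()) h∈J)

    heavyOnTime⇒F≤2heavy : ∀ {k} (σ : Schedule P k) {h} → phase h ≡ 1 → J σ h → F σ ≤ heavy + heavy
    heavyOnTime⇒F≤2heavy σ h-heavy h∈J = begin
      F σ                               ≈⟨ heavyOnTime⇒F σ h-heavy h∈J ⟩
      value σ zero + value σ (suc zero) ≤⟨ +-mono-≤ (value≤w σ zero) (value≤w σ (suc zero)) ⟩
      heavy + heavy                     ∎

    heaviesOnTime⇒F : ∀ {k} (σ : Schedule P k) → J σ zero → J σ (suc zero) → F σ ≈ heavy + heavy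
    heaviesOnTime⇒F σ 0∈J 1∈J =
      trans (heavyOnTime⇒F σ ≡.refl 0∈J) (+-cong (value-onTime σ 0∈J) (value-onTime σ 1∈J))

    -- Either some heavy job is on time and no light one is, or at most the `m` light jobs count.
    F≤m·light : ∀ {k} (σ : Schedule P k) → F σ ≤ m · light
    F≤m·light σ = cases (J? σ zero) (J? σ (suc zero))
      where
      cases : Dec (J σ zero) → Dec (J σ (suc zero)) → F σ ≤ m · light
      cases (yes 0∈J) _         = ≤-trans (heavyOnTime⇒F≤2heavy σ ≡.refl 0∈J) heavy+heavy≤m·light
      cases (no _)    (yes 1∈J) = ≤-trans (heavyOnTime⇒F≤2heavy σ ≡.refl 1∈J) heavy+heavy≤m·light
      cases (no 0∉J)  (no 1∉J)  = begin
        F σ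
          ≈⟨ +-cong (value-late σ 0∉J) (+-congʳ (value-late σ 1∉J)) ⟩
        0# + (0# + sum (λ i → value σ (suc (suc i))))
          ≈⟨ trans (+-identityˡ _) (+-identityˡ _) ⟩
        sum (λ i → value σ (suc (suc i)))
          ≤⟨ sum-upperBound (λ i → value≤w σ (suc (suc i))) ⟩
        m · light ∎

    -- The optimum on `m` machines.

    lightSchedule : Schedule P m
    -- `id` settles the conflicts because an edge is by definition an inequality of phases, which
    -- are the slots here.
    lightSchedule = slotSchedule phase machine injective id
      where
      machine : Fin (2 ℕ.+ m) → Fin m
      machine zero          = zero
      machine (suc zero)    = suc zero
      machine (suc (suc i)) = i

      injective : ∀ {i j} → machine i ≡ machine j → phase i ≡ phase j → i ≡ j
      injective {zero}        {zero}        _  _ = ≡.refl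
      injective {zero}        {suc zero}    () _
      injective {zero}        {suc (suc _)} _  ()
      injective {suc zero}    {suc zero}    _  _ = ≡.refl
      injective {suc zero}    {suc (suc _)} _  ()
      injective {suc (suc i)} {suc (suc j)} eq _ = ≡.cong (λ i → suc (suc i)) eq

    slot0-onTime : fromℕ 0 + 1# ≤ fromℕ 1
    slot0-onTime = ≤-reflexive (fromℕ-suc 0)

    m·light≤F : m · light ≤ F lightSchedule
    m·light≤F = begin
      m · light
        ≤⟨ sum-lowerBound {f = lightValue} light≤value ⟩
      sum lightValue
        ≈⟨ trans (+-identityˡ _) (+-identityˡ _) ⟨
      0# + (0# + sum lightValue)
        ≤⟨ +-mono-≤ (value-nonNegative lightSchedule zero)
             (+-monoˡ-≤ (sum lightValue) (value-nonNegative lightSchedule (suc zero))) ⟩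
      F lightSchedule ∎
      where
      lightValue : Fin m → Carrier
      lightValue i = value lightSchedule (suc (suc i))

      light≤value : ∀ i → light ≤ lightValue i
      light≤value i = ≤-reflexive (sym (value-onTime lightSchedule {suc (suc i)} slot0-onTime))

    lightSchedule-optimal : IsOptimal lightSchedule
    lightSchedule-optimal τ = ≤-trans (F≤m·light τ) m·light≤F

    2≤Cmax : ∀ {k} (σ : Schedule P k) → fromℕ 2 ≤ Cmax σ
    -- A heavy and a light job conflict: their phases are 1 and 0, so `λ ()` proves the edge.
    2≤Cmax σ = disjoint⇒2≤Cmax σ {zero} {suc (suc zero)} (λ t → Schedule.conflict σ λ ())

    lightSchedule-Cmax≤2 : Cmax lightSchedule ≤ fromℕ 2
    lightSchedule-Cmax≤2 = Cmax-least lightSchedule (·-nonNegative 2 0≤1) C≤2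
      where
      phase≤1 : ∀ j → phase j ℕ.≤ 1
      phase≤1 zero          = s≤s z≤n
      phase≤1 (suc zero)    = s≤s z≤n
      phase≤1 (suc (suc _)) = z≤n

      C≤2 : ∀ j → fromℕ (phase j) + 1# ≤ fromℕ 2
      C≤2 j = ≤-trans (≤-reflexive (fromℕ-suc (phase j))) (·-monoˡ-≤ 0≤1 (s≤s (phase≤1 j)))

    lightSchedule-minimal : ∀ (τ : Schedule P m) → Cmax lightSchedule ≤ Cmax τ
    lightSchedule-minimal τ = ≤-trans lightSchedule-Cmax≤2 (2≤Cmax τ)

    1<2 : fromℕ 1 < fromℕ 2
    1<2 = <-respʳ-≈ (fromℕ-suc 1) (x<x+y (fromℕ 1) 0<1)

    1<Cmax : ∀ {k} (σ : Schedule P k) → fromℕ 1 < Cmax σ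
    1<Cmax σ = begin-strict fromℕ 1 <⟨ 1<2 ⟩ fromℕ 2 ≤⟨ 2≤Cmax σ ⟩ Cmax σ ∎

    I : Instance m
    I = toInstance P lightSchedule lightSchedule-minimal (1<Cmax lightSchedule)

    -- The optimum on two machines.

    heavySchedule : Schedule P 2
    heavySchedule = slotSchedule slot machine injective conflictFree
      where
      slot : Fin (2 ℕ.+ m) → ℕ
      slot zero          = 0
      slot (suc zero)    = 0
      -- The light jobs queue up one after another; `suc` leaves slot 0 to the heavy jobs.
      slot (suc (suc i)) = suc (toℕ i)

      machine : Fin (2 ℕ.+ m) → Fin 2
      machine zero          = zero
      machine (suc zero)    = suc zero
      machine (suc (suc _)) = zero

      injective : ∀ {i j} → machine i ≡ machine j → slot i ≡ slot j → i ≡ j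
      injective {zero}        {zero}        _ _  = ≡.refl
      injective {zero}        {suc zero}    () _
      injective {zero}        {suc (suc _)} _ ()
      injective {suc zero}    {suc zero}    _ _  = ≡.refl
      injective {suc zero}    {suc (suc _)} _ ()
      injective {suc (suc i)} {suc (suc j)} _ eq =
        ≡.cong (λ i → suc (suc i)) (toℕ-injective (ℕ.suc-injective eq))

      conflictFree : ∀ {i j} → phase i ≢ phase j → slot i ≢ slot j
      conflictFree {zero}        {zero}        i≁j _ = i≁j ≡.refl
      conflictFree {zero}        {suc zero}    i≁j _ = i≁j ≡.refl
      conflictFree {suc zero}    {zero}        i≁j _ = i≁j ≡.refl
      conflictFree {suc zero}    {suc zero}    i≁j _ = i≁j ≡.refl
      conflictFree {suc (suc _)} {suc (suc _)} i≁j _ = i≁j ≡.refl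

    -- Counts machines where `F≤m·light` counts jobs: with deadline 1 each machine completes at most
    -- one job on time, and it is light.
    lightOnly⇒F≤k·light : ∀ {k} (σ : Schedule P k) → ¬ J σ zero → ¬ J σ (suc zero) → F σ ≤ k · light
    lightOnly⇒F≤k·light σ 0∉J 1∉J = ≤-trans (≤-reflexive (F≈∑load σ)) (sum-upperBound load≤light)
      where
      open Schedule σ using (machine)

      onTime⇒w≤light : ∀ {j} → J σ j → weight j ≤ light
      onTime⇒w≤light {zero}        j∈J = contradiction j∈J 0∉J
      onTime⇒w≤light {suc zero}    j∈J = contradiction j∈J 1∉J
      onTime⇒w≤light {suc (suc _)} _   = ≤-refl

      load≤light : ∀ i → load σ i ≤ light
      load≤light i = sum-atMostOne {P = λ j → machine j ≡ i × J σ j} (proj₁ 0<light)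
        (λ (mᵢ , i∈J) (mⱼ , j∈J) → unitDeadline-capacity σ ≡.refl (≡.trans mᵢ (≡.sym mⱼ)) i∈J j∈J)
        bound
        where
        on : Fin (2 ℕ.+ m) → Carrier
        on j = if does (machine j Fin.≟ i) then value σ j else 0#

        bound : ∀ j → ((machine j ≡ i × J σ j) × on j ≤ light) ⊎ on j ≤ 0#
        bound j with machine j Fin.≟ i | J? σ j
        ... | no _    | _       = inj₂ ≤-refl
        ... | yes _   | no _    = inj₂ ≤-refl
        ... | yes m≡i | yes j∈J = inj₁ ((m≡i , j∈J) , onTime⇒w≤light j∈J)

    -- The alternatives are a single heavy job, which excludes the light ones, or at most two light
    -- jobs.
    ¬heaviesOnTime⇒F<2heavy : ∀ (σ : Schedule P 2) → ¬ (J σ zero × J σ (suc zero)) → F σ < heavy + heavy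
    ¬heaviesOnTime⇒F<2heavy σ ¬both = cases (J? σ zero) (J? σ (suc zero))
      where
      cases : Dec (J σ zero) → Dec (J σ (suc zero)) → F σ < heavy + heavy
      cases (yes 0∈J) (yes 1∈J) = contradiction (0∈J , 1∈J) ¬both
      cases (yes 0∈J) (no 1∉J)  = begin-strict
        F σ                               ≈⟨ heavyOnTime⇒F σ ≡.refl 0∈J ⟩
        value σ zero + value σ (suc zero) ≤⟨ +-mono-≤ (value≤w σ zero) (≤-reflexive (value-late σ 1∉J)) ⟩
        heavy + 0#                        <⟨ +-monoʳ-< heavy 0<heavy ⟩
        heavy + heavy                     ∎
      cases (no 0∉J)  (yes 1∈J) = begin-strict
        F σ                               ≈⟨ heavyOnTime⇒F σ ≡.refl 1∈J ⟩
        value σ zero + value σ (suc zero) ≤⟨ +-mono-≤ (≤-reflexive (value-late σ 0∉J)) (value≤w σ (suc zero)) ⟩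
        0# + heavy                        <⟨ +-mono-<-≤ 0<heavy ≤-refl ⟩
        heavy + heavy                     ∎
      cases (no 0∉J)  (no 1∉J)  = begin-strict
        F σ                  ≤⟨ lightOnly⇒F≤k·light σ 0∉J 1∉J ⟩
        light + (light + 0#) ≈⟨ +-congˡ (+-identityʳ light) ⟩
        light + light        <⟨ +-mono-<-≤ light<heavy (proj₁ light<heavy) ⟩
        heavy + heavy        ∎

    -- Otherwise `heavySchedule` would be strictly better. Since this covers every optimal schedule,
    -- it applies to whichever σ₂ comes with membership in `𝔄`.
    optimal⇒heaviesOnTime : ∀ (σ : Schedule P 2) → IsOptimal σ → J σ zero × J σ (suc zero)
    optimal⇒heaviesOnTime σ optimal = decidable-stable (J? σ zero ×-dec J? σ (suc zero)) λ ¬both →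
      <⇒≱ (¬heaviesOnTime⇒F<2heavy σ ¬both) (begin
        heavy + heavy     ≈⟨ heaviesOnTime⇒F heavySchedule slot0-onTime slot0-onTime ⟨
        F heavySchedule   ≤⟨ optimal heavySchedule ⟩
        F σ               ∎)

    heaviesOnTime⇒[m/2-ε]F<F : ∀ (σ : Schedule P m) → J σ zero → J σ (suc zero) →
                            (fromℕ m / fromℕ 2 - ε) * F σ < F lightSchedule
    heaviesOnTime⇒[m/2-ε]F<F σ 0∈J 1∈J = begin-strict
      (fromℕ m / fromℕ 2 - ε) * F σ
        ≈⟨ *-congˡ (heaviesOnTime⇒F σ 0∈J 1∈J) ⟩
      (fromℕ m / fromℕ 2 - ε) * (heavy + heavy)
        ≈⟨ [y-z]x≈yx-zx (heavy + heavy) (fromℕ m / fromℕ 2) ε ⟩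
      fromℕ m / fromℕ 2 * (heavy + heavy) - ε * (heavy + heavy)
        <⟨ x<y+z⇒x-z<y (ε * (heavy + heavy)) half ⟩
      m · light
        ≤⟨ m·light≤F ⟩
      F lightSchedule ∎
      where
      -- The difference between `heavy + heavy` and `fromℕ m`; its positivity gives
      -- `m ε < ε (heavy + heavy)`.
      rest : Carrier
      rest = (ε + ε) + (ε + heavy)

      0<rest : 0# < rest
      0<rest = begin-strict
        0#                    <⟨ 0<heavy ⟩
        heavy                 ≈⟨ +-identityˡ heavy ⟨
        0# + heavy            ≤⟨ +-monoˡ-≤ heavy (+-nonNegative (+-nonNegative 0≤ε 0≤ε) 0≤ε) ⟩
        ((ε + ε) + ε) + heavy ≈⟨ +-assoc (ε + ε) ε heavy ⟩
        rest                  ∎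
        where
        0≤ε : 0# ≤ ε
        0≤ε = proj₁ 0<ε

      -- The left side is `m` heavy weights, that is `m` light ones plus `m ε`, and `m ε` falls
      -- short of `ε (heavy + heavy)` by `ε * rest`.
      half : fromℕ m / fromℕ 2 * (heavy + heavy) < m · light + ε * (heavy + heavy)
      half = begin-strict
        fromℕ m / fromℕ 2 * (heavy + heavy)
          ≈⟨ solve 2 (λ x h → x :* (h :+ h) := (x :+ x) :* h) refl (fromℕ m / fromℕ 2) heavy ⟩
        (fromℕ m / fromℕ 2 + fromℕ m / fromℕ 2) * heavy
          ≈⟨ *-congʳ (x/2+x/2≈x (fromℕ m)) ⟩
        fromℕ m * (light + ε)
          ≈⟨ distribˡ (fromℕ m) light ε ⟩
        fromℕ m * light + fromℕ m * ε
          <⟨ +-monoʳ-< (fromℕ m * light) (x<x+y (fromℕ m * ε) (*-positive 0<ε 0<rest)) ⟩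
        fromℕ m * light + (fromℕ m * ε + ε * rest)
          ≈⟨ +-cong (sym (·≈fromℕ* m light))
               -- One copy of `heavy` is expanded into `fromℕ m + (ε + ε) + ε`; the other stays the
               -- variable `h`.
               (solve 3 (λ x e h → x :* e :+ e :* ((e :+ e) :+ (e :+ h))
                                   := e :* (((x :+ (e :+ e)) :+ e) :+ h)) refl (fromℕ m) ε heavy) ⟩
        m · light + ε * (heavy + heavy) ∎

  -- The guarantee and its tightness.

  F≤m/2*F : ∀ n (A : Algorithm (2 ℕ.+ n)) → A ∈ 𝔄 (2 ℕ.+ n) → ∀ I (σ : Schedule (problem I) (2 ℕ.+ n)) →
            F σ ≤ fromℕ (2 ℕ.+ n) / fromℕ 2 * F (A I)
  F≤m/2*F n A A∈𝔄 I σ = let (σ₂ , σ₂-optimal , J⊆) = A∈𝔄 I in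
    -- The bound `b` is `F (A I)`: every two-machine value is at most `F σ₂`, and the on-time jobs
    -- of σ₂ are on time in `A I`.
    F≤m/2*bound n σ (λ τ → ≤-trans (σ₂-optimal τ) (F-mono σ₂ (A I) J⊆))

  -- The instance depends on `n` and `ε` only, so a single one defeats all algorithms in the class.
  m/2-tight : ∀ n (A : Algorithm (3 ℕ.+ n)) → A ∈ 𝔄 (3 ℕ.+ n) → ∀ ε → 0# < ε →
              Σ[ I ∈ Instance (3 ℕ.+ n) ] Σ[ σ* ∈ Schedule (problem I) (3 ℕ.+ n) ] IsOptimal σ* ×
                (fromℕ (3 ℕ.+ n) / fromℕ 2 - ε) * F (A I) < F σ*
  m/2-tight n A A∈𝔄 ε 0<ε =
    let open Tightness n 0<ε
        (σ₂ , σ₂-optimal , J⊆) = A∈𝔄 I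
        (0∈J , 1∈J) = optimal⇒heaviesOnTime σ₂ σ₂-optimal
    in I , lightSchedule , lightSchedule-optimal , heaviesOnTime⇒[m/2-ε]F<F (A I) (J⊆ 0∈J) (J⊆ 1∈J)

theorem1 :
  ∀ {c ℓ₁ ℓ₂} (K : OrderedField c ℓ₁ ℓ₂) →
  let open OrderedField K
      open Scheduling K
      open Scheduling.Instance using (problem) in
  ∀ (m : ℕ) → 2 ℕ.< m →
  ∀ (A : Algorithm m) → A ∈ 𝔄 m →
    (∀ (I : Instance m) (σ* : Schedule (problem I) m) → IsOptimal σ* →
      F σ* ≤ fromℕ m / fromℕ 2 * F (A I))
    ×
    (∀ ε → 0# < ε →
      Σ[ I ∈ Instance m ] Σ[ σ* ∈ Schedule (problem I) m ] IsOptimal σ* ×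
        (fromℕ m / fromℕ 2 - ε) * F (A I) < F σ*)
-- Matching on `2 < m` makes `m` equal to `3 + n`; the upper bound is phrased for `2 + n`, hence its
-- argument `suc n`.
theorem1 K (suc (suc (suc n))) (s≤s (s≤s (s≤s _))) A A∈𝔄 =
  (λ I σ* _ → F≤m/2*F (suc n) A A∈𝔄 I σ*) , m/2-tight n A A∈𝔄
  where open SchedulingProperties K
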